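{- Let $p$ be a prime and let $w=(a_n)_{n=1}^\infty$ be an infinite word on the alphabet $\{0,1,\dots,p-1\}$. Suppose there is a sequence $(w_j)_{j=1}^\infty$ of finite words on this alphabet and a sequence $(\delta_j)_{j=1}^\infty$ of positive real numbers, each less than $1$, such that for every $j$ the word $w_jw_jw_j^{\delta_j}$ occurs as a subword in $w$, and $\lim_{j\to\infty}|w_j^{\delta_j}|=\infty$. Then the real number $w_p=\sum_{n=1}^\infty a_np^{ -n}$ satisfies the $p$-adic Littlewood conjecture.
   Context: Words: subwords are blocks of consecutive letters; $|v|$ denotes the length of a word $v$; juxtaposition denotes concatenation. For a finite word $v$ and $\delta\in(0,1)$, $v^{\delta}$ denotes the prefix of $v$ of length $\lfloor \delta\cdot|v|\rfloor$ (this is not a power of $v$). A real number $x$ satisfies the $p$-adic Littlewood conjecture (pLC) if $\liminf_{q\to\infty} q\cdot|q|_p\cdot\|qx\|=0$, where $q$ runs over the positive integers, $|\cdot|_p$ is the $p$-adic absolute value and $\|\cdot\|$ is the distance to the nearest integer. -}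

module Defs where

open import Data.Fin using (Fin; toℕ)
import Data.Fin.Properties as Fin
open import Data.Integer as ℤ using (ℤ; +_; 0ℤ; 1ℤ)
import Data.Integer.DivMod as ℤ
import Data.Integer.Properties as ℤ
open import Data.List using (List; length; lookup; take; filter; upTo)
open import Data.List.Extrema.Nat using (max)
open import Data.Nat as ℕ using (ℕ; zero; suc; NonZero; NonTrivial; _^_)
open import Data.Nat.Divisibility using (_∣?_)
open import Data.Nat.Primality using (Prime; prime⇒nonZero)
import Data.Nat.Properties as ℕ
open import Data.Product using (Σ; ∃; ∃-syntax; _×_; _,_; proj₁; proj₂)
open import Data.Rational as ℚ
  using (ℚ; mkℚ; 0ℚ; 1ℚ; ½; _/_; _+_; _-_; -_; _*_; _⊓_; floor; ↥_; ↧_; ↧ₙ_; toℚᵘ)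
import Data.Rational.Properties as ℚ
import Data.Rational.Unnormalised as ℚᵘ
import Data.Rational.Unnormalised.Properties as ℚᵘ
open import Data.Rational.Solver using (module +-*-Solver)
open import Data.Sum using (_⊎_; inj₁; inj₂)
open import Relation.Nullary using (yes; no)
open import Relation.Binary.PropositionalEquality

------------------------------------------------------------------------
-- Real numbers, as Cauchy sequences of rationals

IsCauchy : (ℕ → ℚ) → Set
IsCauchy x = ∀ ε → 0ℚ ℚ.< ε →
  ∃[ N ] (∀ m n → N ℕ.≤ m → N ℕ.≤ n → ℚ.∣ x m - x n ∣ ℚ.< ε)

record ℝ : Set where
  constructor mkℝ
  field
    seq    : ℕ → ℚ
    cauchy : IsCauchy seq

open ℝ public

infix 4 _<ℝ_ _≤ℝ_

_<ℝ_ : ℝ → ℝ → Set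
x <ℝ y = ∃[ ε ] (0ℚ ℚ.< ε) × ∃[ N ] (∀ n → N ℕ.≤ n → seq x n + ε ℚ.< seq y n)

-- Equivalent to the negation of y <ℝ x; it does not require the
-- approximating sequences to be ordered termwise.
_≤ℝ_ : ℝ → ℝ → Set
x ≤ℝ y = ∀ ε → 0ℚ ℚ.< ε → ∃[ N ] (∀ n → N ℕ.≤ n → seq x n ℚ.< seq y n + ε)

ι : ℚ → ℝ
ι r = mkℝ (λ _ → r) λ ε 0<ε → 0 , λ _ _ _ _ →
  subst (ℚ._< ε) (sym (cong ℚ.∣_∣ (ℚ.+-inverseʳ r))) 0<ε

0ℝ 1ℝ : ℝ
0ℝ = ι 0ℚ
1ℝ = ι 1ℚ

ℕ→ℚ : ℕ → ℚ
ℕ→ℚ n = + n / 1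

divPow : ℤ → (b : ℕ) .{{_ : NonZero b}} → ℕ → ℚ
divPow i b n = (i / b ^ n) {{ℕ.m^n≢0 b n}}

Lipschitz : (K : ℚ) → (ℚ → ℚ) → Set
Lipschitz K f = ∀ r s → ℚ.∣ f r - f s ∣ ℚ.≤ K * ℚ.∣ r - s ∣

private
  *-pos : ∀ {p q} → 0ℚ ℚ.< p → 0ℚ ℚ.< q → 0ℚ ℚ.< p * q
  *-pos {p} {q} 0<p 0<q = ℚ.positive⁻¹ (p * q)
    {{ℚ.pos*pos⇒pos p {{ℚ.positive 0<p}} q {{ℚ.positive 0<q}}}}

-- A Lipschitz function on ℚ extends to ℝ by termwise application.
lift : ∀ K .{{_ : ℚ.Positive K}} (f : ℚ → ℚ) → Lipschitz K f → ℝ → ℝ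
lift K f lip x = mkℝ (λ n → f (seq x n)) λ ε 0<ε →
  let instance K≢0 = ℚ.pos⇒nonZero K
      0<ε/K = *-pos (ℚ.positive⁻¹ (ℚ.1/ K) {{ℚ.1/pos⇒pos K}}) 0<ε
      N , close = cauchy x (ℚ.1/ K * ε) 0<ε/K
  in N , λ m n N≤m N≤n → let open ℚ.≤-Reasoning in begin-strict
    ℚ.∣ f (seq x m) - f (seq x n) ∣  ≤⟨ lip (seq x m) (seq x n) ⟩
    K * ℚ.∣ seq x m - seq x n ∣      <⟨ ℚ.*-monoʳ-<-pos K (close m n N≤m N≤n) ⟩
    K * (ℚ.1/ K * ε)                 ≡⟨ ℚ.*-assoc K (ℚ.1/ K) ε ⟨
    K * ℚ.1/ K * ε                   ≡⟨ cong (_* ε) (ℚ.*-inverseʳ K) ⟩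
    1ℚ * ε                           ≡⟨ ℚ.*-identityˡ ε ⟩
    ε                                ∎

private
  neg-lip : Lipschitz 1ℚ (λ r → - r)
  neg-lip r s = ℚ.≤-reflexive (begin
    ℚ.∣ - r - - s ∣   ≡⟨ cong ℚ.∣_∣ (ℚ.neg-distrib-+ r (- s)) ⟨
    ℚ.∣ - (r - s) ∣   ≡⟨ ℚ.∣-p∣≡∣p∣ (r - s) ⟩
    ℚ.∣ r - s ∣       ≡⟨ ℚ.*-identityˡ _ ⟨
    1ℚ * ℚ.∣ r - s ∣  ∎)
    where open ≡-Reasoning

  ∣-∣-comm : ∀ r s → ℚ.∣ r - s ∣ ≡ ℚ.∣ s - r ∣
  ∣-∣-comm r s = trans (sym (ℚ.∣-p∣≡∣p∣ (r - s))) (cong ℚ.∣_∣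
    (solve 2 (λ r s → :- (r :- s) := s :- r) refl r s))
    where open +-*-Solver

  ∣∣≤ : ∀ {p q} → p ℚ.≤ q → - p ℚ.≤ q → ℚ.∣ p ∣ ℚ.≤ q
  ∣∣≤ {p} p≤q -p≤q with ℚ.∣p∣≡p∨∣p∣≡-p p
  ... | inj₁ eq = subst (ℚ._≤ _) (sym eq) p≤q
  ... | inj₂ eq = subst (ℚ._≤ _) (sym eq) -p≤q

  p≤∣p∣ : ∀ p → p ℚ.≤ ℚ.∣ p ∣
  p≤∣p∣ p with ℚ.≤-total 0ℚ p
  ... | inj₁ 0≤p = ℚ.≤-reflexive (sym (ℚ.0≤p⇒∣p∣≡p 0≤p))
  ... | inj₂ p≤0 = ℚ.≤-trans p≤0 (ℚ.0≤∣p∣ p)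

  -p≤∣p∣ : ∀ p → - p ℚ.≤ ℚ.∣ p ∣
  -p≤∣p∣ p = subst (- p ℚ.≤_) (ℚ.∣-p∣≡∣p∣ p) (p≤∣p∣ (- p))

  ≤+⇒-≤ : ∀ {p q r} → p ℚ.≤ r + q → p - q ℚ.≤ r
  ≤+⇒-≤ {p} {q} {r} p≤r+q = subst (p - q ℚ.≤_)
    (solve 2 (λ r q → r :+ q :- q := r) refl r q) (ℚ.+-monoˡ-≤ (- q) p≤r+q)
    where open +-*-Solver

  -- Subadditivity along r = (r - s) + s gives the Lipschitz property.
  subadd⇒lip : ∀ (f : ℚ → ℚ) → (∀ r s → f r ℚ.≤ ℚ.∣ r - s ∣ + f s) → Lipschitz 1ℚ f
  subadd⇒lip f sub r s = subst (ℚ.∣ f r - f s ∣ ℚ.≤_) (sym (ℚ.*-identityˡ _))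
    (∣∣≤ (≤+⇒-≤ (sub r s))
         (subst₂ ℚ._≤_ (solve 2 (λ a b → b :- a := :- (a :- b)) refl (f r) (f s))
                       (∣-∣-comm s r) (≤+⇒-≤ (sub s r))))
    where open +-*-Solver

  abs-lip : Lipschitz 1ℚ ℚ.∣_∣
  abs-lip = subadd⇒lip ℚ.∣_∣ λ r s → subst (λ t → ℚ.∣ t ∣ ℚ.≤ ℚ.∣ r - s ∣ + ℚ.∣ s ∣)
    (solve 2 (λ r s → r :- s :+ s := r) refl r s) (ℚ.∣p+q∣≤∣p∣+∣q∣ (r - s) s)
    where open +-*-Solver

infix  8 -ℝ_
infixl 7 _·_
infixl 6 _+ℝ_ _-ℝ_

-ℝ_ : ℝ → ℝ
-ℝ_ = lift 1ℚ (λ r → - r) neg-lip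

∣_∣ℝ : ℝ → ℝ
∣_∣ℝ = lift 1ℚ ℚ.∣_∣ abs-lip

_+ℝ_ : ℝ → ℝ → ℝ
x +ℝ y = mkℝ (λ n → seq x n + seq y n) λ ε 0<ε →
  let 0<ε/2 = *-pos (ℚ.positive⁻¹ ½) 0<ε
      M , closeˣ = cauchy x (½ * ε) 0<ε/2
      N , closeʸ = cauchy y (½ * ε) 0<ε/2
  in M ℕ.⊔ N , λ m n h k → let open ℚ.≤-Reasoning in begin-strict
    ℚ.∣ seq x m + seq y m - (seq x n + seq y n) ∣
      ≡⟨ cong ℚ.∣_∣ (solve 4 (λ a b c d → a :+ b :- (c :+ d) := (a :- c) :+ (b :- d))
                     refl (seq x m) (seq y m) (seq x n) (seq y n)) ⟩
    ℚ.∣ (seq x m - seq x n) + (seq y m - seq y n) ∣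
      ≤⟨ ℚ.∣p+q∣≤∣p∣+∣q∣ (seq x m - seq x n) (seq y m - seq y n) ⟩
    ℚ.∣ seq x m - seq x n ∣ + ℚ.∣ seq y m - seq y n ∣
      <⟨ ℚ.+-mono-<
           (closeˣ m n (ℕ.≤-trans (ℕ.m≤m⊔n M N) h) (ℕ.≤-trans (ℕ.m≤m⊔n M N) k))
           (closeʸ m n (ℕ.≤-trans (ℕ.m≤n⊔m M N) h) (ℕ.≤-trans (ℕ.m≤n⊔m M N) k)) ⟩
    ½ * ε + ½ * ε
      ≡⟨ ℚ.*-distribʳ-+ ε ½ ½ ⟨
    1ℚ * ε
      ≡⟨ ℚ.*-identityˡ ε ⟩
    ε ∎
  where open +-*-Solver

_-ℝ_ : ℝ → ℝ → ℝ
x -ℝ y = x +ℝ -ℝ y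

private
  scale-lip : ∀ c → Lipschitz (ℚ.∣ c ∣ + 1ℚ) (c *_)
  scale-lip c r s = begin
    ℚ.∣ c * r - c * s ∣
      ≡⟨ cong ℚ.∣_∣ (solve 3 (λ c r s → c :* r :- c :* s := c :* (r :- s)) refl c r s) ⟩
    ℚ.∣ c * (r - s) ∣          ≡⟨ ℚ.∣p*q∣≡∣p∣*∣q∣ c (r - s) ⟩
    ℚ.∣ c ∣ * ℚ.∣ r - s ∣      ≤⟨ ℚ.*-monoʳ-≤-nonNeg ℚ.∣ r - s ∣ {{ℚ.∣-∣-nonNeg (r - s)}} ∣c∣≤ ⟩
    (ℚ.∣ c ∣ + 1ℚ) * ℚ.∣ r - s ∣  ∎
    where
    open ℚ.≤-Reasoning
    open +-*-Solver
    ∣c∣≤ : ℚ.∣ c ∣ ℚ.≤ ℚ.∣ c ∣ + 1ℚ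
    ∣c∣≤ = subst (ℚ._≤ ℚ.∣ c ∣ + 1ℚ) (ℚ.+-identityʳ ℚ.∣ c ∣)
             (ℚ.+-monoʳ-≤ ℚ.∣ c ∣ (ℚ.<⇒≤ (ℚ.positive⁻¹ 1ℚ)))

_·_ : ℚ → ℝ → ℝ
c · x = lift (ℚ.∣ c ∣ + 1ℚ)
  {{ℚ.nonNeg+pos⇒pos ℚ.∣ c ∣ {{ℚ.∣-∣-nonNeg c}} 1ℚ}} (c *_) (scale-lip c) x

------------------------------------------------------------------------
-- Distance to the nearest integer

distℚ : ℚ → ℚ
distℚ r = (r - floor r / 1) ⊓ (1ℚ - (r - floor r / 1))

private
  ≃ᵘ-/1 : ∀ i → toℚᵘ (i / 1) ℚᵘ.≃ (i ℚᵘ./ 1)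
  ≃ᵘ-/1 i = ℚ.toℚᵘ-fromℚᵘ (i ℚᵘ./ 1)

  /1-mono-≤ : ∀ {i j} → i ℤ.≤ j → i / 1 ℚ.≤ j / 1
  /1-mono-≤ {i} {j} i≤j = ℚ.toℚᵘ-cancel-≤
    (ℚᵘ.≤-respˡ-≃ (ℚᵘ.≃-sym (≃ᵘ-/1 i)) (ℚᵘ.≤-respʳ-≃ (ℚᵘ.≃-sym (≃ᵘ-/1 j))
      (ℚᵘ.*≤* (subst₂ ℤ._≤_ (sym (ℤ.*-identityʳ i)) (sym (ℤ.*-identityʳ j)) i≤j))))

  suc/1 : ∀ i → ℤ.suc i / 1 ≡ 1ℚ + i / 1
  suc/1 i = ℚ.toℚᵘ-injective (ℚᵘ.≃-trans (≃ᵘ-/1 (ℤ.suc i)) (ℚᵘ.≃-sym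
    (ℚᵘ.≃-trans (ℚ.toℚᵘ-homo-+ 1ℚ (i / 1)) (ℚᵘ.≃-trans (ℚᵘ.+-congʳ (toℚᵘ 1ℚ) (≃ᵘ-/1 i))
      (ℚᵘ.*≡* (cong (λ z → (+ 1 ℤ.+ z) ℤ.* + 1) (ℤ.*-identityʳ i)))))))

  floor≤ : ∀ r → floor r / 1 ℚ.≤ r
  floor≤ r@record{} = ℚ.toℚᵘ-cancel-≤ (ℚᵘ.≤-respˡ-≃ (ℚᵘ.≃-sym (≃ᵘ-/1 (floor r)))
    (ℚᵘ.*≤* (subst (floor r ℤ.* ↧ r ℤ.≤_) (sym (ℤ.*-identityʳ (↥ r)))
      (ℤ.[n/d]*d≤n (↥ r) (↧ r)))))

  <1+floor : ∀ r → r ℚ.< 1ℚ + floor r / 1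
  <1+floor r@record{} = subst (r ℚ.<_) (suc/1 (floor r))
    (ℚ.toℚᵘ-cancel-< (ℚᵘ.<-respʳ-≃ (ℚᵘ.≃-sym (≃ᵘ-/1 (ℤ.suc (floor r))))
      (ℚᵘ.*<* (subst₂ ℤ._<_ (sym (ℤ.*-identityʳ (↥ r)))
        (cong (λ z → ℤ.suc z ℤ.* ↧ r) (sym (ℤ.div-pos-is-/ℕ (↥ r) (↧ₙ r))))
        (ℤ.n<s[n/ℕd]*d (↥ r) (↧ₙ r))))))

-- distℚ r is the distance from r to the set of integers: it is a lower
-- bound for the distances to all integers, and it is attained.
distℚ-lower : ∀ r m → distℚ r ℚ.≤ ℚ.∣ r - m / 1 ∣
distℚ-lower r m with m ℤ.≤? floor r
... | yes m≤f = ℚ.≤-trans (ℚ.p⊓q≤p (r - floor r / 1) _)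
  (ℚ.≤-trans (ℚ.+-monoʳ-≤ r (ℚ.neg-antimono-≤ (/1-mono-≤ m≤f))) (p≤∣p∣ (r - m / 1)))
... | no m≰f = ℚ.≤-trans (ℚ.p⊓q≤q (r - floor r / 1) _) (begin
  1ℚ - (r - floor r / 1)
    ≡⟨ solve 3 (λ o r f → o :- (r :- f) := (o :+ f) :- r) refl 1ℚ r (floor r / 1) ⟩
  1ℚ + floor r / 1 - r
    ≤⟨ ℚ.+-monoˡ-≤ (- r) (subst (ℚ._≤ m / 1) (suc/1 (floor r)) (/1-mono-≤ (ℤ.i<j⇒suc[i]≤j (ℤ.≰⇒> m≰f)))) ⟩
  m / 1 - r        ≡⟨ solve 2 (λ m r → m :- r := :- (r :- m)) refl (m / 1) r ⟩
  - (r - m / 1)    ≤⟨ -p≤∣p∣ (r - m / 1) ⟩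
  ℚ.∣ r - m / 1 ∣  ∎)
  where
  open ℚ.≤-Reasoning
  open +-*-Solver

distℚ-attained : ∀ r → ∃[ m ] distℚ r ≡ ℚ.∣ r - m / 1 ∣
distℚ-attained r with ℚ.⊓-sel (r - floor r / 1) (1ℚ - (r - floor r / 1))
... | inj₁ eq = floor r , trans eq (sym (ℚ.0≤p⇒∣p∣≡p
  (subst (ℚ._≤ r - floor r / 1) (ℚ.+-inverseʳ (floor r / 1))
    (ℚ.+-monoˡ-≤ (- (floor r / 1)) (floor≤ r)))))
... | inj₂ eq = ℤ.suc (floor r) , trans eq (begin
  1ℚ - (r - floor r / 1)
    ≡⟨ solve 3 (λ o r f → o :- (r :- f) := (o :+ f) :- r) refl 1ℚ r (floor r / 1) ⟩
  1ℚ + floor r / 1 - r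
    ≡⟨ ℚ.0≤p⇒∣p∣≡p (subst (ℚ._≤ 1ℚ + floor r / 1 - r) (ℚ.+-inverseʳ r)
         (ℚ.+-monoˡ-≤ (- r) (ℚ.<⇒≤ (<1+floor r)))) ⟨
  ℚ.∣ 1ℚ + floor r / 1 - r ∣
    ≡⟨ ∣-∣-comm (1ℚ + floor r / 1) r ⟩
  ℚ.∣ r - (1ℚ + floor r / 1) ∣
    ≡⟨ cong (λ t → ℚ.∣ r - t ∣) (suc/1 (floor r)) ⟨
  ℚ.∣ r - ℤ.suc (floor r) / 1 ∣ ∎)
  where
  open ≡-Reasoning
  open +-*-Solver

distℚ-lip : Lipschitz 1ℚ distℚ
distℚ-lip = subadd⇒lip distℚ λ r s →
  let m , eq = distℚ-attained s
      open ℚ.≤-Reasoning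
  in begin
    distℚ r                              ≤⟨ distℚ-lower r m ⟩
    ℚ.∣ r - m / 1 ∣
      ≡⟨ cong ℚ.∣_∣ (solve 3 (λ r s m → r :- m := (r :- s) :+ (s :- m)) refl r s (m / 1)) ⟩
    ℚ.∣ (r - s) + (s - m / 1) ∣          ≤⟨ ℚ.∣p+q∣≤∣p∣+∣q∣ (r - s) (s - m / 1) ⟩
    ℚ.∣ r - s ∣ + ℚ.∣ s - m / 1 ∣        ≡⟨ cong (λ t → ℚ.∣ r - s ∣ + t) eq ⟨
    ℚ.∣ r - s ∣ + distℚ s                ∎
  where open +-*-Solver

‖_‖ : ℝ → ℝ
‖_‖ = lift 1ℚ distℚ distℚ-lip

------------------------------------------------------------------------
-- Infimum, limit, limit inferior and floor

IsInfimum : {I : Set} → (I → ℝ) → ℝ → Set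
IsInfimum f b = (∀ i → b ≤ℝ f i) × (∀ ε → 0ℚ ℚ.< ε → ∃[ i ] f i <ℝ b +ℝ ι ε)

_⟶_ : (ℕ → ℝ) → ℝ → Set
f ⟶ l = ∀ ε → 0ℚ ℚ.< ε → ∃[ N ] (∀ n → N ℕ.≤ n → ∣ f n -ℝ l ∣ℝ <ℝ ι ε)

-- The limit of the infima of the tails f N, f (N + 1), ...
IsLimInf : (ℕ → ℝ) → ℝ → Set
IsLimInf f l = ∃[ g ] (∀ N → IsInfimum (λ n → f (N ℕ.+ n)) (g N)) × g ⟶ l

_⟶∞ : (ℕ → ℕ) → Set
u ⟶∞ = ∀ M → ∃[ J ] (∀ j → J ℕ.≤ j → M ℕ.≤ u j)

-- The floor of a real number is not computable, so it is a relation.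
IsFloor : ℝ → ℤ → Set
IsFloor x k = ι (k / 1) ≤ℝ x × x <ℝ ι (k / 1) +ℝ 1ℝ

------------------------------------------------------------------------
-- The p-adic Littlewood conjecture

-- The exponents k with p ^ k dividing q ≥ 1 are all smaller than q.
valuation : ℕ → ℕ → ℕ
valuation p q = max 0 (filter (λ k → p ^ k ∣? q) (upTo q))

∣_∣[_,_] : ℕ → (p : ℕ) → Prime p → ℚ
∣ zero      ∣[ p , _       ] = 0ℚ
∣ q@(suc _) ∣[ p , p-prime ] = divPow 1ℤ p {{prime⇒nonZero p-prime}} (valuation p q)

SatisfiesPLC : (p : ℕ) → Prime p → ℝ → Set
SatisfiesPLC p p-prime x = IsLimInf term 0ℝ
  where
  -- q = suc n runs over the positive integers.
  term : ℕ → ℝ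
  term n = let q = suc n in (ℕ→ℚ q * ∣ q ∣[ p , p-prime ]) · ‖ ℕ→ℚ q · x ‖

------------------------------------------------------------------------
-- Words

Word : ℕ → Set
Word p = List (Fin p)

-- The letter a_n of an infinite word (n ≥ 1) is the value at n - 1.
InfiniteWord : ℕ → Set
InfiniteWord p = ℕ → Fin p

OccursIn : ∀ {p} → Word p → InfiniteWord p → Set
OccursIn v a = ∃[ k ] (∀ i → a (k ℕ.+ toℕ i) ≡ lookup v i)

-- u is the prefix of v of length ⌊ δ · |v| ⌋.
IsFractionalPrefix : ∀ {p} → ℝ → Word p → Word p → Set
IsFractionalPrefix δ v u =
  ∃[ k ] IsFloor (ℕ→ℚ (length v) · δ) (+ k) × u ≡ take k v

------------------------------------------------------------------------
-- The real number with a given base b expansion, as the limit of partial sums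

module _ (b : ℕ) {{b≥2 : NonTrivial b}} where

  private
    instance
      b≢0 : NonZero b
      b≢0 = ℕ.nonTrivial⇒nonZero b

  -- The sum of a_i b ^ (- i) for 1 ≤ i ≤ n.
  partialSum : InfiniteWord b → ℕ → ℚ
  partialSum a zero    = 0ℚ
  partialSum a (suc n) = partialSum a n + divPow (+ toℕ (a n)) b (suc n)

  upper : InfiniteWord b → ℕ → ℚ
  upper a n = partialSum a n + divPow 1ℤ b n

  divPow-nonNeg : ∀ k n → 0ℚ ℚ.≤ divPow (+ k) b n
  divPow-nonNeg k n = ℚ.nonNegative⁻¹ (divPow (+ k) b n) {{ℚ.normalize-nonNeg k (b ^ n) {{ℕ.m^n≢0 b n}}}}

  private
    bound : ∀ k c d .{{_ : NonZero c}} .{{_ : NonZero d}} → k ℕ.< b → d ≡ b ℕ.* c →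
            (+ k ℚᵘ./ d) ℚᵘ.+ (1ℤ ℚᵘ./ d) ℚᵘ.≤ (1ℤ ℚᵘ./ c)
    bound k (suc c) (suc d) k<b eq = ℚᵘ.*≤* (subst₂ ℤ._≤_ lhs rhs (ℤ.+≤+ ineq))
      where
      C D : ℕ
      C = suc c
      D = suc d
      ineq : (k ℕ.* D ℕ.+ 1 ℕ.* D) ℕ.* C ℕ.≤ 1 ℕ.* (D ℕ.* D)
      ineq = let open ℕ.≤-Reasoning in begin
        (k ℕ.* D ℕ.+ 1 ℕ.* D) ℕ.* C  ≡⟨ cong (ℕ._* C) (ℕ.*-distribʳ-+ D k 1) ⟨
        (k ℕ.+ 1) ℕ.* D ℕ.* C        ≡⟨ cong (λ z → z ℕ.* D ℕ.* C) (ℕ.+-comm k 1) ⟩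
        suc k ℕ.* D ℕ.* C            ≤⟨ ℕ.*-monoˡ-≤ C (ℕ.*-monoˡ-≤ D k<b) ⟩
        b ℕ.* D ℕ.* C                ≡⟨ cong (ℕ._* C) (ℕ.*-comm b D) ⟩
        D ℕ.* b ℕ.* C                ≡⟨ ℕ.*-assoc D b C ⟩
        D ℕ.* (b ℕ.* C)              ≡⟨ cong (D ℕ.*_) eq ⟨
        D ℕ.* D                      ≡⟨ ℕ.*-identityˡ (D ℕ.* D) ⟨
        1 ℕ.* (D ℕ.* D)              ∎
      lhs : + ((k ℕ.* D ℕ.+ 1 ℕ.* D) ℕ.* C) ≡ (+ k ℤ.* + D ℤ.+ 1ℤ ℤ.* + D) ℤ.* + C
      lhs = trans (ℤ.pos-* (k ℕ.* D ℕ.+ 1 ℕ.* D) C)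
        (cong (ℤ._* + C) (cong₂ ℤ._+_ (ℤ.pos-* k D) (ℤ.pos-* 1 D)))
      rhs : + (1 ℕ.* (D ℕ.* D)) ≡ 1ℤ ℤ.* + (D ℕ.* D)
      rhs = ℤ.pos-* 1 (D ℕ.* D)

  divPow-step : ∀ k n → k ℕ.< b → divPow (+ k) b (suc n) + divPow 1ℤ b (suc n) ℚ.≤ divPow 1ℤ b n
  divPow-step k n k<b = go (b ^ n) {{ℕ.m^n≢0 b n}} (b ^ suc n) {{ℕ.m^n≢0 b (suc n)}} refl
    where
    open ℚᵘ.≤-Reasoning
    to/ : ∀ i d .{{_ : NonZero d}} → toℚᵘ (i / d) ℚᵘ.≃ (i ℚᵘ./ d)
    to/ i (suc d) = ℚ.toℚᵘ-fromℚᵘ (i ℚᵘ./ suc d)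
    go : ∀ c .{{_ : NonZero c}} d .{{_ : NonZero d}} → d ≡ b ℕ.* c → + k / d + 1ℤ / d ℚ.≤ 1ℤ / c
    go c d eq = ℚ.toℚᵘ-cancel-≤ (begin
      toℚᵘ (+ k / d + 1ℤ / d)              ≃⟨ ℚ.toℚᵘ-homo-+ (+ k / d) (1ℤ / d) ⟩
      toℚᵘ (+ k / d) ℚᵘ.+ toℚᵘ (1ℤ / d)    ≃⟨ ℚᵘ.+-cong (to/ (+ k) d) (to/ 1ℤ d) ⟩
      (+ k ℚᵘ./ d) ℚᵘ.+ (1ℤ ℚᵘ./ d)        ≤⟨ bound k c d k<b eq ⟩
      1ℤ ℚᵘ./ c                            ≃⟨ to/ 1ℤ c ⟨
      toℚᵘ (1ℤ / c)                        ∎)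

  partialSum-mono : ∀ a N k → partialSum a N ℚ.≤ partialSum a (k ℕ.+ N)
  partialSum-mono a N zero    = ℚ.≤-refl
  partialSum-mono a N (suc k) = ℚ.≤-trans (partialSum-mono a N k)
    (subst (ℚ._≤ partialSum a (suc k ℕ.+ N)) (ℚ.+-identityʳ _)
      (ℚ.+-monoʳ-≤ (partialSum a (k ℕ.+ N)) (divPow-nonNeg (toℕ (a (k ℕ.+ N))) (suc (k ℕ.+ N)))))

  upper-anti : ∀ a N k → upper a (k ℕ.+ N) ℚ.≤ upper a N
  upper-anti a N zero    = ℚ.≤-refl
  upper-anti a N (suc k) = ℚ.≤-trans
    (subst (ℚ._≤ upper a (k ℕ.+ N)) (sym (ℚ.+-assoc (partialSum a (k ℕ.+ N)) _ _))
      (ℚ.+-monoʳ-≤ (partialSum a (k ℕ.+ N))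
        (divPow-step (toℕ (a (k ℕ.+ N))) (k ℕ.+ N) (Fin.toℕ<n (a (k ℕ.+ N))))))
    (upper-anti a N k)

  partialSum-between : ∀ a N m → N ℕ.≤ m →
            partialSum a N ℚ.≤ partialSum a m × partialSum a m ℚ.≤ upper a N
  partialSum-between a N m N≤m = subst (λ m → partialSum a N ℚ.≤ partialSum a m × partialSum a m ℚ.≤ upper a N)
    (ℕ.m∸n+n≡m N≤m)
    ( partialSum-mono a N (m ℕ.∸ N)
    , ℚ.≤-trans (subst (ℚ._≤ upper a (m ℕ.∸ N ℕ.+ N)) (ℚ.+-identityʳ _)
        (ℚ.+-monoʳ-≤ (partialSum a (m ℕ.∸ N ℕ.+ N)) (divPow-nonNeg 1 (m ℕ.∸ N ℕ.+ N))))
        (upper-anti a N (m ℕ.∸ N)))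

  partialSum-difference : ∀ a N m n → N ℕ.≤ m → N ℕ.≤ n →
               partialSum a m - partialSum a n ℚ.≤ divPow 1ℤ b N
  partialSum-difference a N m n N≤m N≤n = subst (partialSum a m - partialSum a n ℚ.≤_)
    (solve 2 (λ s t → s :+ t :- s := t) refl (partialSum a N) (divPow 1ℤ b N))
    (ℚ.+-mono-≤ (proj₂ (partialSum-between a N m N≤m))
                (ℚ.neg-antimono-≤ (proj₁ (partialSum-between a N n N≤n))))
    where open +-*-Solver

  n<b^n : ∀ n → n ℕ.< b ^ n
  n<b^n zero    = ℕ.s≤s ℕ.z≤n
  n<b^n (suc n) = ℕ.≤-<-trans (n<b^n n)
    (ℕ.^-monoʳ-< b (ℕ.nonTrivial⇒n>1 b) (ℕ.n<1+n n))

  divPow-small : ∀ ε → 0ℚ ℚ.< ε → divPow 1ℤ b (↧ₙ ε) ℚ.< ε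
  divPow-small ε@(mkℚ i d _) 0<ε = lem (b ^ suc d) {{ℕ.m^n≢0 b (suc d)}} (n<b^n (suc d)) i (ℚ.positive 0<ε) refl
    where
    lem : ∀ c .{{_ : NonZero c}} → suc d ℕ.< c → ∀ j → ℤ.Positive j → i ≡ j → 1ℤ / c ℚ.< ε
    lem (suc c) d<c (+ suc j) _ refl = ℚ.toℚᵘ-cancel-<
      (ℚᵘ.<-respˡ-≃ (ℚᵘ.≃-sym (ℚ.toℚᵘ-fromℚᵘ (1ℤ ℚᵘ./ suc c)))
        (ℚᵘ.*<* (subst₂ ℤ._<_ (ℤ.pos-* 1 (suc d)) (ℤ.pos-* (suc j) (suc c)) (ℤ.+<+
          (ℕ.<-≤-trans (subst (ℕ._< suc c) (sym (ℕ.*-identityˡ (suc d))) d<c)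
            (ℕ.m≤m+n (suc c) (j ℕ.* suc c)))))))

  partialSum-cauchy : ∀ a → IsCauchy (partialSum a)
  partialSum-cauchy a ε 0<ε = ↧ₙ ε , λ m n N≤m N≤n → ℚ.≤-<-trans
    (∣∣≤ (partialSum-difference a (↧ₙ ε) m n N≤m N≤n)
         (subst (ℚ._≤ divPow 1ℤ b (↧ₙ ε))
           (solve 2 (λ s t → t :- s := :- (s :- t)) refl (partialSum a m) (partialSum a n))
           (partialSum-difference a (↧ₙ ε) n m N≤n N≤m)))
    (divPow-small ε 0<ε)
    where open +-*-Solver

  expansion : InfiniteWord b → ℝ
  expansion a = mkℝ (partialSum a) (partialSum-cauchy a)

{-# OPTIONS --safe #-}

-- Let x = 0.a in base b.  If w w wᵟ occurs in a after k letters, with |w| = L and |wᵟ| = M, then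
-- b ^ k x has fractional part y = 0.w w wᵟ…, and multiplying by b ^ L - 1
-- gives, modulo 1, the difference of 0.w wᵟ… and y, which share their first
-- L + M digits.  So q = b ^ k (b ^ L - 1) satisfies ‖ q x ‖ ≤ b ^ (- (L + M)),
-- whereas q |q| ≤ b ^ L; their product is at most b ^ (- M).

module Submission where

open import Data.Fin as Fin using (toℕ; fromℕ<)
open import Data.Fin.Properties using (toℕ-fromℕ<)
open import Data.Integer as ℤ using (+_; 1ℤ)
import Data.Integer.Properties as ℤ
open import Data.List using (List; []; _∷_; length; lookup; take; drop; filter; upTo; _++_)
open import Data.List.Extrema.Nat using (xs≤max)
open import Data.List.Membership.Propositional.Properties using (∈-filter⁺; ∈-upTo⁺)
open import Data.List.Properties using (length-++; ++-assoc; take++drop≡id)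
import Data.List.Relation.Unary.All as All
open import Data.Nat as ℕ using (ℕ; zero; suc; pred; NonZero; NonTrivial; _^_)
open import Data.Nat.Divisibility using (_∣_; _∣?_; ∣m⇒∣m*n; ∣-refl)
open import Data.Nat.Primality using (Prime; prime⇒nonTrivial)
import Data.Nat.Properties as ℕ
open import Data.Product using (∃-syntax; _×_; _,_; proj₁; proj₂)
open import Data.Rational as ℚ using (ℚ; 0ℚ; 1ℚ; ½; _/_; _+_; _-_; _*_; ↧ₙ_; toℚᵘ)
import Data.Rational.Properties as ℚ
open import Data.Rational.Solver using (module +-*-Solver)
import Data.Rational.Unnormalised as ℚᵘ
import Data.Rational.Unnormalised.Properties as ℚᵘ
open import Data.Sum using (inj₁; inj₂)
open import Function using (_∘_)
open import Relation.Binary.PropositionalEquality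
open import Defs

-- Fractions of naturals, and distances in ℚ.

toℚᵘ-/ : ∀ i d .{{_ : NonZero d}} → toℚᵘ (i / d) ℚᵘ.≃ (i ℚᵘ./ d)
toℚᵘ-/ i (suc d) = ℚ.toℚᵘ-fromℚᵘ (i ℚᵘ./ suc d)

-- Comparisons of fractions reduce here to cross-multiplication in ℕ. The detour through `ℚᵘ` is due
-- to `_/_` normalising to lowest terms.
/-mono-≤ : ∀ m n c d .{{_ : NonZero c}} .{{_ : NonZero d}} →
           m ℕ.* d ℕ.≤ n ℕ.* c → + m / c ℚ.≤ + n / d
/-mono-≤ m n c@(suc _) d@(suc _) md≤nc = ℚ.toℚᵘ-cancel-≤
  (ℚᵘ.≤-respˡ-≃ (ℚᵘ.≃-sym (toℚᵘ-/ (+ m) c)) (ℚᵘ.≤-respʳ-≃ (ℚᵘ.≃-sym (toℚᵘ-/ (+ n) d))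
    (ℚᵘ.*≤* (subst₂ ℤ._≤_ (ℤ.pos-* m d) (ℤ.pos-* n c) (ℤ.+≤+ md≤nc)))))

/-cross : ∀ m n c d .{{_ : NonZero c}} .{{_ : NonZero d}} →
          m ℕ.* d ≡ n ℕ.* c → + m / c ≡ + n / d
/-cross m n c d eq = ℚ.≤-antisym (/-mono-≤ m n c d (ℕ.≤-reflexive eq))
                             (/-mono-≤ n m d c (ℕ.≤-reflexive (sym eq)))

ℕ→ℚ-*-/ : ∀ m n d .{{_ : NonZero d}} → ℕ→ℚ m * (+ n / d) ≡ + (m ℕ.* n) / d
ℕ→ℚ-*-/ m n d@(suc d-1) = ℚ.toℚᵘ-injective (begin-equality
  toℚᵘ (ℕ→ℚ m * (+ n / d))               ≃⟨ ℚ.toℚᵘ-homo-* (ℕ→ℚ m) (+ n / d) ⟩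
  toℚᵘ (ℕ→ℚ m) ℚᵘ.* toℚᵘ (+ n / d)       ≃⟨ ℚᵘ.*-cong (toℚᵘ-/ (+ m) 1) (toℚᵘ-/ (+ n) d) ⟩
  (+ m ℚᵘ./ 1) ℚᵘ.* (+ n ℚᵘ./ d)         ≃⟨ ℚᵘ.*≡* (cong₂ ℤ._*_
                                              (sym (ℤ.pos-* m n)) (cong +_ (sym (ℕ.*-identityˡ d)))) ⟩
  (+ (m ℕ.* n) ℚᵘ./ d)                   ≃⟨ toℚᵘ-/ (+ (m ℕ.* n)) d ⟨
  toℚᵘ (+ (m ℕ.* n) / d)                 ∎)
  where open ℚᵘ.≤-Reasoning

ℕ→ℚ-* : ∀ m n → ℕ→ℚ (m ℕ.* n) ≡ ℕ→ℚ m * ℕ→ℚ n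
ℕ→ℚ-* m n = sym (ℕ→ℚ-*-/ m n 1)

ℕ→ℚ-+ : ∀ m n → ℕ→ℚ (m ℕ.+ n) ≡ ℕ→ℚ m + ℕ→ℚ n
ℕ→ℚ-+ m n = ℚ.toℚᵘ-injective (begin-equality
  toℚᵘ (ℕ→ℚ (m ℕ.+ n))                   ≃⟨ toℚᵘ-/ (+ (m ℕ.+ n)) 1 ⟩
  (+ (m ℕ.+ n) ℚᵘ./ 1)                   ≃⟨ ℚᵘ.*≡* (cong (ℤ._* + 1) (cong₂ ℤ._+_
                                              (sym (ℤ.*-identityʳ (+ m))) (sym (ℤ.*-identityʳ (+ n))))) ⟩
  (+ m ℚᵘ./ 1) ℚᵘ.+ (+ n ℚᵘ./ 1)         ≃⟨ ℚᵘ.+-cong (toℚᵘ-/ (+ m) 1) (toℚᵘ-/ (+ n) 1) ⟨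
  toℚᵘ (ℕ→ℚ m) ℚᵘ.+ toℚᵘ (ℕ→ℚ n)         ≃⟨ ℚ.toℚᵘ-homo-+ (ℕ→ℚ m) (ℕ→ℚ n) ⟨
  toℚᵘ (ℕ→ℚ m + ℕ→ℚ n)                   ∎)
  where open ℚᵘ.≤-Reasoning

∣-∣≤ : ∀ {s d x y} → s ℚ.≤ x → x ℚ.≤ s + d → s ℚ.≤ y → y ℚ.≤ s + d → ℚ.∣ x - y ∣ ℚ.≤ d
∣-∣≤ {s} {d} {x} {y} s≤x x≤s+d s≤y y≤s+d with ℚ.∣p∣≡p∨∣p∣≡-p (x - y)
... | inj₁ eq = subst₂ ℚ._≤_ (sym eq) (solve 2 (λ s d → s :+ d :- s := d) refl s d)
                  (ℚ.+-mono-≤ x≤s+d (ℚ.neg-antimono-≤ s≤y))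
  where open +-*-Solver
... | inj₂ eq = subst₂ ℚ._≤_
                  (trans (solve 2 (λ x y → y :- x := :- (x :- y)) refl x y) (sym eq))
                  (solve 2 (λ s d → s :+ d :- s := d) refl s d)
                  (ℚ.+-mono-≤ y≤s+d (ℚ.neg-antimono-≤ s≤x))
  where open +-*-Solver

distℚ-nonNeg : ∀ r → 0ℚ ℚ.≤ distℚ r
distℚ-nonNeg r = let m , eq = distℚ-attained r in
  subst (0ℚ ℚ.≤_) (sym eq) (ℚ.0≤∣p∣ (r - m / 1))

½*-pos : ∀ {ε} → 0ℚ ℚ.< ε → 0ℚ ℚ.< ½ * ε
½*-pos {ε} 0<ε = ℚ.positive⁻¹ (½ * ε) {{ℚ.pos*pos⇒pos ½ ε {{ℚ.positive 0<ε}}}}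

½*+½* : ∀ ε → ½ * ε + ½ * ε ≡ ε
½*+½* ε = trans (sym (ℚ.*-distribʳ-+ ε ½ ½)) (ℚ.*-identityˡ ε)

½*< : ∀ {ε} → 0ℚ ℚ.< ε → ½ * ε ℚ.< ε
½*< {ε} 0<ε = subst₂ ℚ._<_ (ℚ.+-identityʳ (½ * ε)) (½*+½* ε) (ℚ.+-monoʳ-< (½ * ε) (½*-pos 0<ε))

-- Finite words as prefixes of sequences.

infix 4 _Starts_

-- This is the body of `OccursIn`: an occurrence of `v` in `a` is a `k` with
-- `v Starts a ∘ (k ℕ.+_)`. Keeping it separate allows shifts by composition.
_Starts_ : {A : Set} → List A → (ℕ → A) → Set
v Starts x = ∀ i → x (toℕ i) ≡ lookup v i

starts-++ˡ : ∀ {A : Set} (u : List A) {v} x → u ++ v Starts x → u Starts x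
starts-++ˡ (_ ∷ u) x h Fin.zero    = h Fin.zero
starts-++ˡ (_ ∷ u) x h (Fin.suc i) = starts-++ˡ u (x ∘ suc) (h ∘ Fin.suc) i

starts-++ʳ : ∀ {A : Set} (u : List A) {v} x → u ++ v Starts x → v Starts x ∘ (length u ℕ.+_)
starts-++ʳ []      x h = h
starts-++ʳ (_ ∷ u) x h = starts-++ʳ u (x ∘ suc) (h ∘ Fin.suc)

starts-unique : ∀ {A : Set} (v : List A) x y → v Starts x → v Starts y →
                ∀ i → i ℕ.< length v → x i ≡ y i
starts-unique _ x y hx hy i i<n = subst (λ j → x j ≡ y j) (toℕ-fromℕ< i<n)
  (trans (hx (fromℕ< i<n)) (sym (hy (fromℕ< i<n))))

-- Writing w = u r, both words begin with w u, as w w u = w u r u.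
square-starts : ∀ {A : Set} (u r : List A) x → let w = u ++ r in
                w ++ w ++ u Starts x →
                w ++ u Starts x × w ++ u Starts x ∘ (length w ℕ.+_)
square-starts u r x h =
  starts-++ˡ (w ++ u) x (subst (_Starts x) eq h) , starts-++ʳ w x h
  where
  w = u ++ r
  eq : w ++ w ++ u ≡ (w ++ u) ++ r ++ u
  eq = trans (cong (w ++_) (++-assoc u r u)) (sym (++-assoc w u (r ++ u)))

-- The valuation.

valuation-≥ : ∀ b k q → b ^ k ∣ q → k ℕ.< q → k ℕ.≤ valuation b q
valuation-≥ b k q b^k∣q k<q = All.lookup
  (xs≤max 0 (filter (λ k → b ^ k ∣? q) (upTo q)))
  -- Only exponents below `q` are searched, hence the role of `k<q`.
  (∈-filter⁺ (λ k → b ^ k ∣? q) (∈-upTo⁺ k<q) b^k∣q)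

-- Powers of the base.

module _ (b : ℕ) {{b≥2 : NonTrivial b}} where

  private instance
    b≢0 : NonZero b
    b≢0 = ℕ.nonTrivial⇒nonZero b

  divPow-mono-≤ : ∀ m n i j → m ℕ.* b ^ j ℕ.≤ n ℕ.* b ^ i → divPow (+ m) b i ℚ.≤ divPow (+ n) b j
  divPow-mono-≤ m n i j = /-mono-≤ m n (b ^ i) (b ^ j) {{ℕ.m^n≢0 b i}} {{ℕ.m^n≢0 b j}}

  divPow-cross : ∀ m n i j → m ℕ.* b ^ j ≡ n ℕ.* b ^ i → divPow (+ m) b i ≡ divPow (+ n) b j
  divPow-cross m n i j = /-cross m n (b ^ i) (b ^ j) {{ℕ.m^n≢0 b i}} {{ℕ.m^n≢0 b j}}

  ℕ→ℚ-*-divPow : ∀ m n i → ℕ→ℚ m * divPow (+ n) b i ≡ divPow (+ (m ℕ.* n)) b i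
  ℕ→ℚ-*-divPow m n i = ℕ→ℚ-*-/ m n (b ^ i) {{ℕ.m^n≢0 b i}}

  divPow-suc : ∀ i n → ℕ→ℚ b * divPow (+ i) b (suc n) ≡ divPow (+ i) b n
  divPow-suc i n = trans (ℕ→ℚ-*-divPow b i (suc n)) (divPow-cross (b ℕ.* i) i (suc n) n (begin
    b ℕ.* i ℕ.* b ^ n    ≡⟨ cong (ℕ._* b ^ n) (ℕ.*-comm b i) ⟩
    i ℕ.* b ℕ.* b ^ n    ≡⟨ ℕ.*-assoc i b (b ^ n) ⟩
    i ℕ.* (b ℕ.* b ^ n)  ∎))
    where open ≡-Reasoning

  divPow-anti : ∀ {m n} → m ℕ.≤ n → divPow 1ℤ b n ℚ.≤ divPow 1ℤ b m
  divPow-anti {m} {n} m≤n = divPow-mono-≤ 1 1 n m (ℕ.*-monoʳ-≤ 1 (ℕ.^-monoʳ-≤ b m≤n))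

  -- Partial sums, digit shifts and the distance to the nearest integer.

  partialSum-cong : ∀ x y n → (∀ i → i ℕ.< n → x i ≡ y i) → partialSum b x n ≡ partialSum b y n
  partialSum-cong x y zero    h = refl
  partialSum-cong x y (suc n) h = cong₂ _+_
    (partialSum-cong x y n (λ i i<n → h i (ℕ.m<n⇒m<1+n i<n)))
    (cong (λ d → divPow (+ toℕ d) b (suc n)) (h n ℕ.≤-refl))

  -- Multiplication by `b` moves the point one place: the leading digit becomes the integer part and
  -- every later summand loses one power of `b`.
  partialSum-tail : ∀ x n →
    ℕ→ℚ b * partialSum b x (suc n) ≡ ℕ→ℚ (toℕ (x 0)) + partialSum b (x ∘ suc) n
  partialSum-tail x zero = begin
    ℕ→ℚ b * (0ℚ + divPow (+ d) b 1)  ≡⟨ cong (ℕ→ℚ b *_) (ℚ.+-identityˡ (divPow (+ d) b 1)) ⟩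
    ℕ→ℚ b * divPow (+ d) b 1         ≡⟨ divPow-suc d 0 ⟩
    ℕ→ℚ d                            ≡⟨ ℚ.+-identityʳ (ℕ→ℚ d) ⟨
    ℕ→ℚ d + 0ℚ                       ∎
    where
    open ≡-Reasoning
    d = toℕ (x 0)
  partialSum-tail x (suc n) = begin
    ℕ→ℚ b * (partialSum b x (suc n) + t)              ≡⟨ ℚ.*-distribˡ-+ (ℕ→ℚ b) (partialSum b x (suc n)) t ⟩
    ℕ→ℚ b * partialSum b x (suc n) + ℕ→ℚ b * t        ≡⟨ cong₂ _+_ (partialSum-tail x n) (divPow-suc (toℕ (x (suc n))) (suc n)) ⟩
    ℕ→ℚ d + partialSum b (x ∘ suc) n + t′             ≡⟨ ℚ.+-assoc (ℕ→ℚ d) (partialSum b (x ∘ suc) n) t′ ⟩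
    ℕ→ℚ d + (partialSum b (x ∘ suc) n + t′)           ∎
    where
    open ≡-Reasoning
    d = toℕ (x 0)
    t = divPow (+ toℕ (x (suc n))) b (suc (suc n))
    t′ = divPow (+ toℕ (x (suc n))) b (suc n)

  -- Iterates `partialSum-tail`; `A` is the integer whose base `b` digits are the first `k` letters
  -- of `x`.
  partialSum-shift : ∀ x k n → ∃[ A ]
    ℕ→ℚ (b ^ k) * partialSum b x (k ℕ.+ n) ≡ ℕ→ℚ A + partialSum b (x ∘ (k ℕ.+_)) n
  partialSum-shift x zero n = 0 , trans (ℚ.*-identityˡ (partialSum b x n))
                                        (sym (ℚ.+-identityˡ (partialSum b x n)))
  partialSum-shift x (suc k) n =
    let A , eq = partialSum-shift (x ∘ suc) k n in b ^ k ℕ.* d ℕ.+ A , (begin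
    ℕ→ℚ (b ℕ.* b ^ k) * s               ≡⟨ cong (_* s) (ℕ→ℚ-* b (b ^ k)) ⟩
    ℕ→ℚ b * ℕ→ℚ (b ^ k) * s             ≡⟨ solve 3 (λ b c s → b :* c :* s := c :* (b :* s)) refl (ℕ→ℚ b) (ℕ→ℚ (b ^ k)) s ⟩
    ℕ→ℚ (b ^ k) * (ℕ→ℚ b * s)           ≡⟨ cong (ℕ→ℚ (b ^ k) *_) (partialSum-tail x (k ℕ.+ n)) ⟩
    ℕ→ℚ (b ^ k) * (ℕ→ℚ d + s′)          ≡⟨ ℚ.*-distribˡ-+ (ℕ→ℚ (b ^ k)) (ℕ→ℚ d) s′ ⟩
    ℕ→ℚ (b ^ k) * ℕ→ℚ d + ℕ→ℚ (b ^ k) * s′  ≡⟨ cong₂ _+_ (sym (ℕ→ℚ-* (b ^ k) d)) eq ⟩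
    ℕ→ℚ (b ^ k ℕ.* d) + (ℕ→ℚ A + t)     ≡⟨ ℚ.+-assoc (ℕ→ℚ (b ^ k ℕ.* d)) (ℕ→ℚ A) t ⟨
    ℕ→ℚ (b ^ k ℕ.* d) + ℕ→ℚ A + t       ≡⟨ cong (_+ t) (ℕ→ℚ-+ (b ^ k ℕ.* d) A) ⟨
    ℕ→ℚ (b ^ k ℕ.* d ℕ.+ A) + t         ∎)
    where
    open ≡-Reasoning
    open +-*-Solver
    d = toℕ (x 0)
    s = partialSum b x (suc k ℕ.+ n)
    s′ = partialSum b (x ∘ suc) (k ℕ.+ n)
    t = partialSum b (x ∘ (suc k ℕ.+_)) n

  -- Both sums lie in the interval of length `b ^ (- n)` that begins at the common `n`-th partial
  -- sum.
  partialSum-close : ∀ x y n i j → partialSum b x n ≡ partialSum b y n → n ℕ.≤ i → n ℕ.≤ j →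
                     ℚ.∣ partialSum b x i - partialSum b y j ∣ ℚ.≤ divPow 1ℤ b n
  partialSum-close x y n i j eq n≤i n≤j =
    let lx , ux = partialSum-between b x n i n≤i
        ly , uy = partialSum-between b y n j n≤j
    in ∣-∣≤ lx ux (subst (ℚ._≤ partialSum b y j) (sym eq) ly)
                  (subst (λ s → partialSum b y j ℚ.≤ s + divPow 1ℤ b n) (sym eq) uy)

  -- Since `‖_‖` acts termwise on Cauchy sequences, the estimate is proved for every partial sum
  -- long enough to contain the digits compared.
  dist-period : ∀ a k L n e → suc e ≡ b ^ L →
    (∀ i → i ℕ.< n → a (k ℕ.+ (L ℕ.+ i)) ≡ a (k ℕ.+ i)) →
    ∀ m → k ℕ.+ (L ℕ.+ n) ℕ.≤ m →
    distℚ (ℕ→ℚ (b ^ k ℕ.* e) * partialSum b a m) ℚ.≤ divPow 1ℤ b n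
  dist-period a k L n e 1+e≡b^L periodic m k+L+n≤m =
    subst (λ m → distℚ (ℕ→ℚ (b ^ k ℕ.* e) * partialSum b a m) ℚ.≤ divPow 1ℤ b n)
      m≡ (go (n ℕ.+ r) (ℕ.m≤m+n n r))
    where
    r = m ℕ.∸ (k ℕ.+ (L ℕ.+ n))
    -- In this form `m` admits a shift by `k` followed by a shift by `L`, leaving `n + r ≥ n`
    -- digits.
    m≡ : k ℕ.+ (L ℕ.+ (n ℕ.+ r)) ≡ m
    m≡ = trans (trans (cong (k ℕ.+_) (sym (ℕ.+-assoc L n r))) (sym (ℕ.+-assoc k (L ℕ.+ n) r)))
               (ℕ.m+[n∸m]≡n k+L+n≤m)
    x = a ∘ (k ℕ.+_)
    y = x ∘ (L ℕ.+_)
    go : ∀ i → n ℕ.≤ i →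
         distℚ (ℕ→ℚ (b ^ k ℕ.* e) * partialSum b a (k ℕ.+ (L ℕ.+ i))) ℚ.≤ divPow 1ℤ b n
    -- The integer to compare with collects `e A` from the shift by `k` and `B` from the shift by
    -- `L`; what remains is `sy - sx`.
    go i n≤i = ℚ.≤-trans (distℚ-lower (ℕ→ℚ (b ^ k ℕ.* e) * s) (+ (e ℕ.* A ℕ.+ B)))
      (subst (λ t → ℚ.∣ t ∣ ℚ.≤ divPow 1ℤ b n) (sym difference)
        (partialSum-close y x n i (L ℕ.+ i) (partialSum-cong y x n periodic)
          n≤i (ℕ.m≤n⇒m≤o+n L n≤i)))
      where
      open ≡-Reasoning
      open +-*-Solver
      s = partialSum b a (k ℕ.+ (L ℕ.+ i))
      sx = partialSum b x (L ℕ.+ i)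
      sy = partialSum b y i
      shiftA = partialSum-shift a k (L ℕ.+ i)
      shiftB = partialSum-shift x L i
      A = proj₁ shiftA
      B = proj₁ shiftB
      E = ℕ→ℚ e

      e*A+B : ℕ→ℚ (e ℕ.* A ℕ.+ B) ≡ E * ℕ→ℚ A + ℕ→ℚ B
      e*A+B = trans (ℕ→ℚ-+ (e ℕ.* A) B) (cong (_+ ℕ→ℚ B) (ℕ→ℚ-* e A))

      -- With `b ^ L` written as `1 + e`, multiplying by `e` is shifting by `L` digits and
      -- subtracting `sx`, without truncated subtraction.
      B+sy : (1ℚ + E) * sx ≡ ℕ→ℚ B + sy
      B+sy = trans (cong (_* sx) (trans (sym (ℕ→ℚ-+ 1 e)) (cong ℕ→ℚ 1+e≡b^L))) (proj₂ shiftB)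

      difference : ℕ→ℚ (b ^ k ℕ.* e) * s - ℕ→ℚ (e ℕ.* A ℕ.+ B) ≡ sy - sx
      difference = begin
        ℕ→ℚ (b ^ k ℕ.* e) * s - ℕ→ℚ (e ℕ.* A ℕ.+ B)
          ≡⟨ cong₂ (λ u v → u * s - v) (ℕ→ℚ-* (b ^ k) e) e*A+B ⟩
        ℕ→ℚ (b ^ k) * E * s - (E * ℕ→ℚ A + ℕ→ℚ B)
          ≡⟨ solve 5 (λ c e s f g → c :* e :* s :- (e :* f :+ g) := e :* (c :* s) :- (e :* f :+ g))
               refl (ℕ→ℚ (b ^ k)) E s (ℕ→ℚ A) (ℕ→ℚ B) ⟩
        E * (ℕ→ℚ (b ^ k) * s) - (E * ℕ→ℚ A + ℕ→ℚ B)
          ≡⟨ cong (λ u → E * u - (E * ℕ→ℚ A + ℕ→ℚ B)) (proj₂ shiftA) ⟩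
        E * (ℕ→ℚ A + sx) - (E * ℕ→ℚ A + ℕ→ℚ B)
          ≡⟨ solve 4 (λ e f t g → e :* (f :+ t) :- (e :* f :+ g) :=
                                  (con 1ℚ :+ e) :* t :- t :- g) refl E (ℕ→ℚ A) sx (ℕ→ℚ B) ⟩
        (1ℚ + E) * sx - sx - ℕ→ℚ B
          ≡⟨ cong (λ u → u - sx - ℕ→ℚ B) B+sy ⟩
        ℕ→ℚ B + sy - sx - ℕ→ℚ B
          ≡⟨ solve 3 (λ g t u → g :+ t :- u :- g := t :- u) refl (ℕ→ℚ B) sy sx ⟩
        sy - sx ∎

  -- Bounds for the terms of the limit inferior.

  b^-*-divPow : ∀ L M → ℕ→ℚ (b ^ L) * divPow 1ℤ b (L ℕ.+ M) ≡ divPow 1ℤ b M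
  b^-*-divPow L M = trans (ℕ→ℚ-*-divPow (b ^ L) 1 (L ℕ.+ M))
    (divPow-cross (b ^ L ℕ.* 1) 1 (L ℕ.+ M) M (begin
    b ^ L ℕ.* 1 ℕ.* b ^ M  ≡⟨ cong (ℕ._* b ^ M) (ℕ.*-identityʳ (b ^ L)) ⟩
    b ^ L ℕ.* b ^ M        ≡⟨ ℕ.^-distribˡ-+-* b L M ⟨
    b ^ (L ℕ.+ M)          ≡⟨ ℕ.*-identityˡ (b ^ (L ℕ.+ M)) ⟨
    1 ℕ.* b ^ (L ℕ.+ M)    ∎))
    where open ≡-Reasoning

  -- The number q |q|; on positive q it unfolds to the factor in SatisfiesPLC.
  weight : ℕ → ℚ
  weight q = ℕ→ℚ q * divPow 1ℤ b (valuation b q)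

  -- As `b ^ k` divides `q`, the valuation is at least `k` and cancels the factor `b ^ k`, leaving
  -- at most `e`. The condition `e ≢ 0` gives `k < b ^ k ≤ q`, which puts `k` among the exponents
  -- searched.
  weight-≤ : ∀ k L e → e ≢ 0 → e ℕ.≤ b ^ L → weight (b ^ k ℕ.* e) ℚ.≤ ℕ→ℚ (b ^ L)
  weight-≤ k L e e≢0 e≤b^L = subst (ℚ._≤ ℕ→ℚ (b ^ L)) (sym (ℕ→ℚ-*-divPow q 1 v))
    -- The exponent 0 makes the right-hand denominator `b ^ 0` reduce to 1, so that `ℕ→ℚ (b ^ L)`
    -- matches.
    (divPow-mono-≤ (q ℕ.* 1) (b ^ L) v 0 (begin
      q ℕ.* 1 ℕ.* 1      ≡⟨ trans (ℕ.*-identityʳ (q ℕ.* 1)) (ℕ.*-identityʳ q) ⟩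
      b ^ k ℕ.* e        ≡⟨ ℕ.*-comm (b ^ k) e ⟩
      e ℕ.* b ^ k        ≤⟨ ℕ.*-mono-≤ e≤b^L (ℕ.^-monoʳ-≤ b k≤v) ⟩
      b ^ L ℕ.* b ^ v    ∎))
    where
    open ℕ.≤-Reasoning
    q = b ^ k ℕ.* e
    v = valuation b q
    k≤v : k ℕ.≤ v
    k≤v = valuation-≥ b k q (∣m⇒∣m*n e ∣-refl)
      (ℕ.<-≤-trans (n<b^n b k) (ℕ.m≤m*n (b ^ k) e {{ℕ.≢-nonZero e≢0}}))

  pLC-term : InfiniteWord b → ℕ → ℝ
  pLC-term a n = weight (suc n) · ‖ ℕ→ℚ (suc n) · expansion b a ‖

  weight≥0 : ∀ q → 0ℚ ℚ.≤ weight q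
  weight≥0 q = subst (0ℚ ℚ.≤_) (sym (ℕ→ℚ-*-divPow q 1 v)) (divPow-nonNeg b (q ℕ.* 1) v)
    where v = valuation b q

  pLC-term≥0 : ∀ a n → 0ℝ ≤ℝ pLC-term a n
  pLC-term≥0 a n ε 0<ε = 0 , λ m _ → ℚ.<-≤-trans 0<ε
    (subst (ℚ._≤ seq (pLC-term a n) m + ε) (ℚ.+-identityˡ ε) (ℚ.+-monoˡ-≤ ε (0≤term m)))
    where
    0≤term : ∀ m → 0ℚ ℚ.≤ seq (pLC-term a n) m
    0≤term m = ℚ.nonNegative⁻¹ _ {{ℚ.nonNeg*nonNeg⇒nonNeg
      (weight (suc n)) {{ℚ.nonNegative (weight≥0 (suc n))}}
      _ {{ℚ.nonNegative (distℚ-nonNeg (ℕ→ℚ (suc n) * partialSum b a m))}}}}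

  -- Agreement over `L + M` digits, not just `M`, pays for the weight `b ^ L`. The threshold on `m`
  -- is the end of the occurrence of the repetition.
  pLC-term-period : ∀ a k L M e n → suc e ≡ b ^ L → suc n ≡ b ^ k ℕ.* e →
    (∀ i → i ℕ.< L ℕ.+ M → a (k ℕ.+ (L ℕ.+ i)) ≡ a (k ℕ.+ i)) →
    ∀ m → k ℕ.+ (L ℕ.+ (L ℕ.+ M)) ℕ.≤ m → seq (pLC-term a n) m ℚ.≤ divPow 1ℤ b M
  pLC-term-period a k L M e n 1+e≡b^L 1+n≡ periodic m m-large = begin
    weight (suc n) * d
      ≤⟨ ℚ.*-monoʳ-≤-nonNeg d {{ℚ.nonNegative (distℚ-nonNeg (ℕ→ℚ (suc n) * partialSum b a m))}} weight≤ ⟩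
    ℕ→ℚ (b ^ L) * d
      ≤⟨ ℚ.*-monoˡ-≤-nonNeg (ℕ→ℚ (b ^ L)) {{ℚ.normalize-nonNeg (b ^ L) 1}} dist≤ ⟩
    ℕ→ℚ (b ^ L) * divPow 1ℤ b (L ℕ.+ M)
      ≡⟨ b^-*-divPow L M ⟩
    divPow 1ℤ b M ∎
    where
    open ℚ.≤-Reasoning
    d = distℚ (ℕ→ℚ (suc n) * partialSum b a m)
    e≢0 : e ≢ 0
    -- `e = 0` would make the positive number `suc n` equal to `b ^ k * 0`.
    e≢0 refl with () ← trans 1+n≡ (ℕ.*-zeroʳ (b ^ k))
    weight≤ : weight (suc n) ℚ.≤ ℕ→ℚ (b ^ L)
    weight≤ = subst (λ q → weight q ℚ.≤ ℕ→ℚ (b ^ L)) (sym 1+n≡)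
      (weight-≤ k L e e≢0 (subst (e ℕ.≤_) 1+e≡b^L (ℕ.n≤1+n e)))
    dist≤ : d ℚ.≤ divPow 1ℤ b (L ℕ.+ M)
    dist≤ = subst (λ q → distℚ (ℕ→ℚ q * partialSum b a m) ℚ.≤ divPow 1ℤ b (L ℕ.+ M)) (sym 1+n≡)
      (dist-period a k L (L ℕ.+ M) e 1+e≡b^L periodic m m-large)

  -- The length of `u` serves twice: it forces `q > N`, so the term lies in the required tail, and
  -- it makes `b ^ (- M)` smaller than `½ * ε`. The other half of `ε` is the rational margin that
  -- `_<ℝ_` demands.
  pLC-term-small : ∀ a u r → let w = u ++ r in OccursIn (w ++ w ++ u) a →
    ∀ N ε → 0ℚ ℚ.< ε → suc N ℕ.+ ↧ₙ (½ * ε) ℕ.≤ length u →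
    ∃[ n ] pLC-term a (N ℕ.+ n) <ℝ 0ℝ +ℝ ι ε
  pLC-term-small a u r (k , occ) N ε 0<ε u-long =
    -- The term with index `n` belongs to `suc n`, so this offset makes `suc (N + n)` equal to `q`.
    q ℕ.∸ suc N , ½ * ε , ½*-pos 0<ε , k ℕ.+ (L ℕ.+ (L ℕ.+ M)) , λ m m-large →
    let open ℚ.≤-Reasoning in begin-strict
    seq (pLC-term a (N ℕ.+ (q ℕ.∸ suc N))) m + ½ * ε
      ≤⟨ ℚ.+-monoˡ-≤ (½ * ε) (pLC-term-period a k L M e (N ℕ.+ (q ℕ.∸ suc N)) 1+e≡b^L
           (ℕ.m+[n∸m]≡n N<q) periodic m m-large) ⟩
    divPow 1ℤ b M + ½ * ε
      ≤⟨ ℚ.+-monoˡ-≤ (½ * ε) (divPow-anti (ℕ.≤-trans (ℕ.m≤n+m (↧ₙ (½ * ε)) (suc N)) u-long)) ⟩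
    divPow 1ℤ b (↧ₙ (½ * ε)) + ½ * ε
      <⟨ ℚ.+-monoˡ-< (½ * ε) (divPow-small b (½ * ε) (½*-pos 0<ε)) ⟩
    ½ * ε + ½ * ε
      ≡⟨ ½*+½* ε ⟩
    ε
      ≡⟨ ℚ.+-identityˡ ε ⟨
    0ℚ + ε ∎
    where
    w = u ++ r
    L = length w
    M = length u
    e = pred (b ^ L)
    q = b ^ k ℕ.* e

    1+e≡b^L : suc e ≡ b ^ L
    1+e≡b^L = ℕ.suc-pred (b ^ L) {{ℕ.m^n≢0 b L}}

    N<q : suc N ℕ.≤ q
    N<q = begin
      suc N                      ≤⟨ ℕ.m≤m+n (suc N) (↧ₙ (½ * ε)) ⟩
      suc N ℕ.+ ↧ₙ (½ * ε)       ≤⟨ u-long ⟩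
      M                          ≤⟨ ℕ.m≤m+n M (length r) ⟩
      M ℕ.+ length r             ≡⟨ length-++ u ⟨
      L                          ≤⟨ ℕ.s≤s⁻¹ (subst (L ℕ.<_) (sym 1+e≡b^L) (n<b^n b L)) ⟩
      e                          ≤⟨ ℕ.m≤n*m e (b ^ k) {{ℕ.m^n≢0 b k}} ⟩
      q                          ∎
      where open ℕ.≤-Reasoning

    periodic : ∀ i → i ℕ.< L ℕ.+ M → a (k ℕ.+ (L ℕ.+ i)) ≡ a (k ℕ.+ i)
    periodic i i<L+M =
      let first , second = square-starts u r (a ∘ (k ℕ.+_)) occ
      in starts-unique (w ++ u) (λ i → a (k ℕ.+ (L ℕ.+ i))) (a ∘ (k ℕ.+_)) second first i
           (subst (i ℕ.<_) (sym (length-++ w)) i<L+M)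

  -- The limit inferior.

  pLC-of-repetitions : ∀ a (w u : ℕ → Word b) →
    (∀ j → ∃[ k ] u j ≡ take k (w j)) →
    (∀ j → OccursIn (w j ++ w j ++ u j) a) →
    (λ j → length (u j)) ⟶∞ →
    IsLimInf (pLC-term a) 0ℝ
  pLC-of-repetitions a w u isPrefix occurs long =
    -- Every tail has infimum 0: its terms are nonnegative, and `small` finds arbitrarily small
    -- ones. The sequence of infima is thus constant.
    (λ _ → 0ℝ) , (λ N → (λ n → pLC-term≥0 a (N ℕ.+ n)) , small N) ,
    λ ε 0<ε → 0 , λ _ _ → ½ * ε , ½*-pos 0<ε , 0 , λ _ _ →
      subst (ℚ._< ε) (sym (ℚ.+-identityˡ (½ * ε))) (½*< 0<ε)
    where
    small : ∀ N ε → 0ℚ ℚ.< ε → ∃[ n ] pLC-term a (N ℕ.+ n) <ℝ 0ℝ +ℝ ι ε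
    small N ε 0<ε =
      let j , h = long (suc N ℕ.+ ↧ₙ (½ * ε))
          k , u≡take = isPrefix j
          -- The prefix hypothesis becomes the splitting `w j ≡ u j ++ r`, the form in which the
          -- repetition is analysed.
          r = drop k (w j)
          w≡ = trans (sym (take++drop≡id k (w j))) (cong (_++ r) (sym u≡take))
      in pLC-term-small a (u j) r
           (subst (λ v → OccursIn (v ++ v ++ u j) a) w≡ (occurs j)) N ε 0<ε (h j ℕ.≤-refl)

theorem2p1 : (p : ℕ) (p-prime : Prime p) (a : InfiniteWord p)
    (w : ℕ → Word p) (δ : ℕ → ℝ) (wᵟ : ℕ → Word p) →
    (∀ j → 0ℝ <ℝ δ j × δ j <ℝ 1ℝ) →
    (∀ j → IsFractionalPrefix (δ j) (w j) (wᵟ j)) →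
    (∀ j → OccursIn (w j ++ w j ++ wᵟ j) a) →
    (λ j → length (wᵟ j)) ⟶∞ →
    SatisfiesPLC p p-prime (expansion p {{prime⇒nonTrivial p-prime}} a)
theorem2p1 p p-prime a w δ wᵟ _ isPrefix =
  -- The conclusion is the goal by definitional unfolding, the nonzero proofs inside `divPow` being
  -- irrelevant.
  pLC-of-repetitions p {{prime⇒nonTrivial p-prime}} a w wᵟ
    (λ j → let k , _ , wᵟ≡take = isPrefix j in k , wᵟ≡take)
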